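{- Let $\mathbb M_0$ be the set of non-negative elements of $\mathbb Z[\mathsf X]$, and let $\mathfrak A:=\begin{pmatrix}9&3\mathsf X+2\\3\mathsf X+4&\mathsf X^2+2\mathsf X+1\end{pmatrix}$ (a matrix with entries in $\mathbb M_0$ and determinant $1$). Then $\mathfrak A$ is neither of the form $\mathtt A^P$ for any $P\in\mathbb M_0$, nor of the form $\beta\,\mathtt B\,\mathtt A^P$ for any $P\in\mathbb M_0$ and any $2\times 2$ matrix $\beta$ with entries in $\mathbb M_0$ and determinant $1$. Consequently, $\mathsf{PA}^-$ does not prove that every determinant-$1$ $2\times2$ matrix is of one of these two forms.
   Context: $\mathbb Z[\mathsf X]$ is ordered by: a non-zero polynomial is positive iff its leading coefficient is positive; $\mathbb M_0$ is a model of $\mathsf{PA}^-$, the theory, in the language $0,1,+,\times,\leq$, of the non-negative parts of discretely ordered commutative rings. $\mathtt A^P:=\begin{pmatrix}1&P\\0&1\end{pmatrix}$, $\mathtt B:=\begin{pmatrix}1&0\\1&1\end{pmatrix}$. -}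

module Defs where

open import Data.Integer using (ℤ; +_; _≤_) renaming (_+_ to _+ℤ_; _*_ to _*ℤ_; -_ to -ℤ_)
open import Data.Integer.Properties using () renaming (_≟_ to _≟ℤ_)
open import Data.Nat using (ℕ; zero; suc)
open import Data.List using (List; []; _∷_; map)
open import Data.Product using (_×_)
open import Relation.Binary.PropositionalEquality using (_≡_)
open import Relation.Nullary using (yes; no)

-- The polynomial ring ℤ[X]: a polynomial is its list of coefficients,
-- constant term first.  Trailing zeros are allowed; equality of
-- polynomials is therefore coefficientwise (setoid) equality.

Poly : Set
Poly = List ℤ

coeff : Poly → ℕ → ℤ
coeff []      _       = + 0
coeff (a ∷ p) zero    = a
coeff (a ∷ p) (suc n) = coeff p n

infix 4 _≈_
_≈_ : Poly → Poly → Set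
p ≈ q = ∀ n → coeff p n ≡ coeff q n

infixl 6 _+ₚ_ _-ₚ_
infixl 7 _*ₚ_

_+ₚ_ : Poly → Poly → Poly
[]      +ₚ q       = q
(a ∷ p) +ₚ []      = a ∷ p
(a ∷ p) +ₚ (b ∷ q) = (a +ℤ b) ∷ (p +ₚ q)

-ₚ_ : Poly → Poly
-ₚ p = map -ℤ_ p

_-ₚ_ : Poly → Poly → Poly
p -ₚ q = p +ₚ (-ₚ q)

_*ₚ_ : Poly → Poly → Poly
[]      *ₚ q = []
(a ∷ p) *ₚ q = map (a *ℤ_) q +ₚ (+ 0 ∷ (p *ₚ q))

0ₚ 1ₚ : Poly
0ₚ = []
1ₚ = + 1 ∷ []

lead : Poly → ℤ
lead []      = + 0
lead (a ∷ p) with lead p ≟ℤ + 0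
... | yes _ = a
... | no  _ = lead p

-- The order on ℤ[X]: non-zero p is positive iff its leading coefficient
-- is positive.  Hence p ≥ 0 iff lead p ≥ 0.  M₀ = { p | NonNeg p }.
NonNeg : Poly → Set
NonNeg p = + 0 ≤ lead p

record Mat : Set where
  constructor mat
  field
    a b c d : Poly
open Mat public

infix 4 _≈M_
_≈M_ : Mat → Mat → Set
M ≈M N = (a M ≈ a N) × (b M ≈ b N) × (c M ≈ c N) × (d M ≈ d N)

infixl 7 _·_
_·_ : Mat → Mat → Mat
M · N = mat (a M *ₚ a N +ₚ b M *ₚ c N) (a M *ₚ b N +ₚ b M *ₚ d N)
            (c M *ₚ a N +ₚ d M *ₚ c N) (c M *ₚ b N +ₚ d M *ₚ d N)

det : Mat → Poly
det M = a M *ₚ d M -ₚ b M *ₚ c M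

InM₀ : Mat → Set
InM₀ M = NonNeg (a M) × NonNeg (b M) × NonNeg (c M) × NonNeg (d M)

𝙰^ : Poly → Mat
𝙰^ P = mat 1ₚ P 0ₚ 1ₚ

𝙱 : Mat
𝙱 = mat 1ₚ 0ₚ 1ₚ 1ₚ

𝔄 : Mat
𝔄 = mat (+ 9 ∷ []) (+ 2 ∷ + 3 ∷ []) (+ 4 ∷ + 3 ∷ []) (+ 1 ∷ + 2 ∷ + 1 ∷ [])

-- 𝔄 has top-left entry 9 ≠ 1, so it is not 𝙰^P.  For β = (p q ; r s) the top row
-- of β 𝙱 𝙰^P is (p + q , (p + q) P + q).  Two non-negative polynomials whose sum is
-- the constant 9 are themselves constant (their non-constant parts are non-negative
-- and sum to 0), so the X-coefficient of the top-right entry is 9 P₁, which cannot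
-- be 3.
module Submission where

open import Defs
open import Data.Integer using (+_; -[1+_]; +≤+; _≤_) renaming (_+_ to _+ℤ_; _*_ to _*ℤ_)
open import Data.Integer.Properties using (+-identityˡ; +-identityʳ; *-identityʳ; *-zeroˡ; *-zeroʳ; *-comm; +-injective) renaming (_≟_ to _≟ℤ_)
open import Data.Nat using (zero; suc; z≤n)
open import Data.Nat.Properties using (m+n≡0⇒m≡0; m+n≡0⇒n≡0)
open import Data.List using ([]; _∷_; map)
open import Data.Product using (_×_; _,_; proj₂)
open import Relation.Binary.PropositionalEquality using (_≡_; _≢_; refl; sym; trans; cong; cong₂; subst; module ≡-Reasoning)
open import Relation.Nullary using (¬_; yes; no; contradiction)

coeff-+ₚ : ∀ p q n → coeff (p +ₚ q) n ≡ coeff p n +ℤ coeff q n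
coeff-+ₚ []      q       n       = sym (+-identityˡ _)
coeff-+ₚ (a ∷ p) []      n       = sym (+-identityʳ _)
coeff-+ₚ (a ∷ p) (b ∷ q) zero    = refl
coeff-+ₚ (a ∷ p) (b ∷ q) (suc n) = coeff-+ₚ p q n

coeff-scale : ∀ c p n → coeff (map (c *ℤ_) p) n ≡ c *ℤ coeff p n
coeff-scale c []      n       = sym (*-zeroʳ c)
coeff-scale c (a ∷ p) zero    = refl
coeff-scale c (a ∷ p) (suc n) = coeff-scale c p n

coeff-*ₚ1ₚ : ∀ p n → coeff (p *ₚ 1ₚ) n ≡ coeff p n
coeff-*ₚ1ₚ []      n       = refl
coeff-*ₚ1ₚ (a ∷ p) zero    = trans (+-identityʳ _) (*-identityʳ a)
coeff-*ₚ1ₚ (a ∷ p) (suc n) = coeff-*ₚ1ₚ p n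

coeff-*ₚ0ₚ : ∀ p n → coeff (p *ₚ 0ₚ) n ≡ + 0
coeff-*ₚ0ₚ []      n       = refl
coeff-*ₚ0ₚ (a ∷ p) zero    = refl
coeff-*ₚ0ₚ (a ∷ p) (suc n) = coeff-*ₚ0ₚ p n

coeff-*ₚ-0 : ∀ p q → coeff (p *ₚ q) 0 ≡ coeff p 0 *ℤ coeff q 0
coeff-*ₚ-0 []      q = sym (*-zeroˡ (coeff q 0))
coeff-*ₚ-0 (a ∷ p) q = trans (coeff-+ₚ (map (a *ℤ_) q) (+ 0 ∷ (p *ₚ q)) 0)
                             (trans (+-identityʳ _) (coeff-scale a q 0))

coeff-*ₚ-1 : ∀ p q → coeff (p *ₚ q) 1 ≡ coeff p 0 *ℤ coeff q 1 +ℤ coeff p 1 *ℤ coeff q 0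
coeff-*ₚ-1 []      q = sym (cong₂ _+ℤ_ (*-zeroˡ (coeff q 1)) (*-zeroˡ (coeff q 0)))
coeff-*ₚ-1 (a ∷ p) q = trans (coeff-+ₚ (map (a *ℤ_) q) (+ 0 ∷ (p *ₚ q)) 1)
                             (cong₂ _+ℤ_ (coeff-scale a q 1) (coeff-*ₚ-0 p q))

lead-∷ : ∀ a p → p ≈ 0ₚ → lead (a ∷ p) ≡ a
lead-∷ a p p≈0 with lead p ≟ℤ + 0
... | yes _     = refl
... | no lead≢0 = contradiction (lead-≈0ₚ p p≈0) lead≢0
  where
  lead-≈0ₚ : ∀ p → p ≈ 0ₚ → lead p ≡ + 0
  lead-≈0ₚ []      _   = refl
  lead-≈0ₚ (b ∷ p) b∷p≈0 = trans (lead-∷ b p (λ n → b∷p≈0 (suc n))) (b∷p≈0 0)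

NonNeg-∷⁻ : ∀ a p → NonNeg (a ∷ p) → NonNeg p
NonNeg-∷⁻ a p a∷p≥0 with lead p ≟ℤ + 0
... | yes lead≡0 = subst (+ 0 ≤_) (sym lead≡0) (+≤+ z≤n)
... | no  _      = a∷p≥0

nonneg-+-≡0⇒≡0 : ∀ {i j} → + 0 ≤ i → + 0 ≤ j → i +ℤ j ≡ + 0 → i ≡ + 0 × j ≡ + 0
nonneg-+-≡0⇒≡0 {+ m} {+ n} (+≤+ _) (+≤+ _) m+n≡0 =
  cong +_ (m+n≡0⇒m≡0 m (+-injective m+n≡0)) , cong +_ (m+n≡0⇒n≡0 m (+-injective m+n≡0))

NonNeg-+ₚ-≈0ₚ : ∀ p q → NonNeg p → NonNeg q → p +ₚ q ≈ 0ₚ → p ≈ 0ₚ × q ≈ 0ₚ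
NonNeg-+ₚ-≈0ₚ []      q       _   _   q≈0   = (λ _ → refl) , q≈0
NonNeg-+ₚ-≈0ₚ (a ∷ p) []      _   _   a∷p≈0 = a∷p≈0 , (λ _ → refl)
NonNeg-+ₚ-≈0ₚ (a ∷ p) (b ∷ q) a∷p≥0 b∷q≥0 sum≈0
  with NonNeg-+ₚ-≈0ₚ p q (NonNeg-∷⁻ a p a∷p≥0) (NonNeg-∷⁻ b q b∷q≥0) (λ n → sum≈0 (suc n))
-- once the tails vanish, the heads are the leading coefficients
... | p≈0 , q≈0 with nonneg-+-≡0⇒≡0 (subst (+ 0 ≤_) (lead-∷ a p p≈0) a∷p≥0)
                                    (subst (+ 0 ≤_) (lead-∷ b q q≈0) b∷q≥0) (sum≈0 0)
... | a≡0 , b≡0 = (λ { zero → a≡0 ; (suc n) → p≈0 n }) , (λ { zero → b≡0 ; (suc n) → q≈0 n })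

Constant : Poly → Set
Constant p = ∀ n → coeff p (suc n) ≡ + 0

NonNeg-+ₚ-Constant : ∀ p q → NonNeg p → NonNeg q → Constant (p +ₚ q) → Constant p × Constant q
NonNeg-+ₚ-Constant []      q       _     _     q-const   = (λ _ → refl) , q-const
NonNeg-+ₚ-Constant (a ∷ p) []      _     _     a∷p-const = a∷p-const , (λ _ → refl)
NonNeg-+ₚ-Constant (a ∷ p) (b ∷ q) a∷p≥0 b∷q≥0 sum-const =
  NonNeg-+ₚ-≈0ₚ p q (NonNeg-∷⁻ a p a∷p≥0) (NonNeg-∷⁻ b q b∷q≥0) sum-const

a-·𝙱 : ∀ M → a (M · 𝙱) ≈ a M +ₚ b M
a-·𝙱 M n = begin
  coeff (a M *ₚ 1ₚ +ₚ b M *ₚ 1ₚ) n        ≡⟨ coeff-+ₚ (a M *ₚ 1ₚ) (b M *ₚ 1ₚ) n ⟩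
  coeff (a M *ₚ 1ₚ) n +ℤ coeff (b M *ₚ 1ₚ) n ≡⟨ cong₂ _+ℤ_ (coeff-*ₚ1ₚ (a M) n) (coeff-*ₚ1ₚ (b M) n) ⟩
  coeff (a M) n +ℤ coeff (b M) n            ≡⟨ coeff-+ₚ (a M) (b M) n ⟨
  coeff (a M +ₚ b M) n                      ∎
  where open ≡-Reasoning

b-·𝙱 : ∀ M → b (M · 𝙱) ≈ b M
b-·𝙱 M n = begin
  coeff (a M *ₚ 0ₚ +ₚ b M *ₚ 1ₚ) n           ≡⟨ coeff-+ₚ (a M *ₚ 0ₚ) (b M *ₚ 1ₚ) n ⟩
  coeff (a M *ₚ 0ₚ) n +ℤ coeff (b M *ₚ 1ₚ) n ≡⟨ cong₂ _+ℤ_ (coeff-*ₚ0ₚ (a M) n) (coeff-*ₚ1ₚ (b M) n) ⟩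
  + 0 +ℤ coeff (b M) n                       ≡⟨ +-identityˡ _ ⟩
  coeff (b M) n                              ∎
  where open ≡-Reasoning

a-·𝙰^ : ∀ M P → a (M · 𝙰^ P) ≈ a M
a-·𝙰^ M P n = begin
  coeff (a M *ₚ 1ₚ +ₚ b M *ₚ 0ₚ) n           ≡⟨ coeff-+ₚ (a M *ₚ 1ₚ) (b M *ₚ 0ₚ) n ⟩
  coeff (a M *ₚ 1ₚ) n +ℤ coeff (b M *ₚ 0ₚ) n ≡⟨ cong₂ _+ℤ_ (coeff-*ₚ1ₚ (a M) n) (coeff-*ₚ0ₚ (b M) n) ⟩
  coeff (a M) n +ℤ + 0                       ≡⟨ +-identityʳ _ ⟩
  coeff (a M) n                              ∎
  where open ≡-Reasoning

coeff-b-·𝙰^-1 : ∀ M P → coeff (b (M · 𝙰^ P)) 1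
                ≡ coeff (a M) 0 *ℤ coeff P 1 +ℤ coeff (a M) 1 *ℤ coeff P 0 +ℤ coeff (b M) 1
coeff-b-·𝙰^-1 M P = begin
  coeff (a M *ₚ P +ₚ b M *ₚ 1ₚ) 1           ≡⟨ coeff-+ₚ (a M *ₚ P) (b M *ₚ 1ₚ) 1 ⟩
  coeff (a M *ₚ P) 1 +ℤ coeff (b M *ₚ 1ₚ) 1 ≡⟨ cong₂ _+ℤ_ (coeff-*ₚ-1 (a M) P) (coeff-*ₚ1ₚ (b M) 1) ⟩
  coeff (a M) 0 *ℤ coeff P 1 +ℤ coeff (a M) 1 *ℤ coeff P 0 +ℤ coeff (b M) 1 ∎
  where open ≡-Reasoning

-- x * 9 rather than 9 * x: only this order reduces far enough to refute each case
3≢x*9 : ∀ x → + 3 ≢ x *ℤ + 9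
3≢x*9 (+ zero)  ()
3≢x*9 (+ suc k) ()
3≢x*9 -[1+ k ]  ()

𝔄-InM₀ : InM₀ 𝔄
𝔄-InM₀ = +≤+ z≤n , +≤+ z≤n , +≤+ z≤n , +≤+ z≤n

det-𝔄 : det 𝔄 ≈ 1ₚ
det-𝔄 0 = refl
det-𝔄 1 = refl
det-𝔄 2 = refl
det-𝔄 3 = refl
det-𝔄 4 = refl
det-𝔄 (suc (suc (suc (suc (suc n))))) = refl

𝔄≉𝙰^ : ∀ P → ¬ (𝔄 ≈M 𝙰^ P)
𝔄≉𝙰^ P (9≈1 , _) with 9≈1 0
... | ()

𝔄≉·𝙱·𝙰^ : ∀ P β → NonNeg (a β) → NonNeg (b β) → ¬ (𝔄 ≈M β · 𝙱 · 𝙰^ P)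
𝔄≉·𝙱·𝙰^ P β aβ≥0 bβ≥0 (a≈ , b≈ , _) = 3≢x*9 (coeff P 1) 3≡P₁9
  where
  open ≡-Reasoning
  M = β · 𝙱
  aM≈9 : a M ≈ a 𝔄
  aM≈9 n = trans (sym (a-·𝙰^ M P n)) (sym (a≈ n))
  bβ₁≡0 : coeff (b β) 1 ≡ + 0
  bβ₁≡0 = proj₂ (NonNeg-+ₚ-Constant (a β) (b β) aβ≥0 bβ≥0
                   (λ n → trans (sym (a-·𝙱 β (suc n))) (aM≈9 (suc n)))) 0
  3≡P₁9 : + 3 ≡ coeff P 1 *ℤ + 9
  3≡P₁9 = begin
    + 3                                                                        ≡⟨ b≈ 1 ⟩
    coeff (b (M · 𝙰^ P)) 1                                                     ≡⟨ coeff-b-·𝙰^-1 M P ⟩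
    coeff (a M) 0 *ℤ coeff P 1 +ℤ coeff (a M) 1 *ℤ coeff P 0 +ℤ coeff (b M) 1 ≡⟨ cong₂ _+ℤ_
                                                                                  (cong₂ _+ℤ_ (cong (_*ℤ coeff P 1) (aM≈9 0))
                                                                                              (cong (_*ℤ coeff P 0) (aM≈9 1)))
                                                                                  (trans (b-·𝙱 β 1) bβ₁≡0) ⟩
    + 9 *ℤ coeff P 1 +ℤ + 0 *ℤ coeff P 0 +ℤ + 0                                ≡⟨ +-identityʳ _ ⟩
    + 9 *ℤ coeff P 1 +ℤ + 0 *ℤ coeff P 0                                       ≡⟨ cong (+ 9 *ℤ coeff P 1 +ℤ_) (*-zeroˡ (coeff P 0)) ⟩
    + 9 *ℤ coeff P 1 +ℤ + 0                                                    ≡⟨ +-identityʳ _ ⟩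
    + 9 *ℤ coeff P 1                                                           ≡⟨ *-comm (+ 9) _ ⟩
    coeff P 1 *ℤ + 9                                                           ∎

mainTheorem7 : (InM₀ 𝔄 × det 𝔄 ≈ 1ₚ)
    × (∀ (P : Poly) → NonNeg P → ¬ (𝔄 ≈M 𝙰^ P))
    × (∀ (P : Poly) (β : Mat) → NonNeg P → InM₀ β → det β ≈ 1ₚ
        → ¬ (𝔄 ≈M β · 𝙱 · 𝙰^ P))
mainTheorem7 = (𝔄-InM₀ , det-𝔄)
             , (λ P _ → 𝔄≉𝙰^ P)
             , (λ P β _ (aβ≥0 , bβ≥0 , _) _ → 𝔄≉·𝙱·𝙰^ P β aβ≥0 bβ≥0)
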